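{- Let $G$ be a graph of order $n\ge 2$ such that each of $G$ and its complement $\overline G$ has an edge. Then $$\frac{5n}{4}-2\ \le\ \operatorname{th}_{\operatorname{Z}}^{\ast}(G)+\operatorname{th}_{\operatorname{Z}}^{\ast}(\overline G),$$ and this lower bound is almost sharp even when both $G$ and $\overline G$ are required to be connected.
   Context: Graphs are finite, simple, undirected, with nonempty vertex set; the order of $G$ is $|V(G)|$; $\overline G$ is the complement of $G$. Standard zero forcing: each vertex is filled or unfilled. Color change rule: if $w$ is the unique unfilled neighbor of a filled vertex $v$, then fill $w$. For $B\subseteq V(G)$ put $B^{[0]}=B$, and let $B^{[i+1]}$ be $B^{[i]}$ together with all vertices that can be filled by one application of the rule when exactly the vertices of $B^{[i]}$ are filled. $\operatorname{pt}_{\operatorname{Z}}(G;B)$ is the least $t$ with $B^{[t]}=V(G)$ ($\infty$ if none exists), and $\operatorname{pt}_{\operatorname{Z}}(G,k)=\min_{|B|=k}\operatorname{pt}_{\operatorname{Z}}(G;B)$. For a graph $G$ of order $n$ with at least one edge, the no initial cost product throttling number is $\operatorname{th}_{\operatorname{Z}}^{\ast}(G)=\min_{1\le k\le n-1}k\cdot\operatorname{pt}_{\operatorname{Z}}(G,k)$. A bound $b(n)$ on $\zeta(G)+\zeta(\overline G)$ (where $n$ is the order of $G$) is almost sharp if, for some positive integer $k<10$, infinitely many graphs $G$ (in the class considered) satisfy $\zeta(G)+\zeta(\overline G)=b(n)\pm k$. -}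

module Defs where

open import Data.Empty using (⊥-elim)
open import Data.Fin using (Fin; zero; suc; _≟_)
open import Data.Fin.Properties using (any?; all?)
open import Data.Fin.Subset using (Subset; ∣_∣; _∈_; ⁅_⁆) renaming (∁ to ∁ˢ)
open import Data.Fin.Subset.Properties
  using (_∈?_; anySubset?; x∈⁅x⁆; x∈⁅y⁆⇒x≡y; x∉p⇒x∈∁p; x∈∁p⇒x∉p; ∣∁p∣≡n∸∣p∣; ∣⁅x⁆∣≡1)
open import Data.Integer using (+_)
open import Data.Nat using (ℕ; zero; suc; _*_; _∸_; _≤_; _<_; z≤n; s≤s; _≤?_)
  renaming (_+_ to _+ℕ_; _≟_ to _≟ℕ_)
import Data.Nat.Properties as ℕ
open import Data.Product using (Σ; ∃; ∃-syntax; _×_; _,_; proj₁; proj₂)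
open import Data.Rational using (ℚ; _/_; _+_; _-_)
open import Data.Sum using (_⊎_; inj₁; inj₂)
open import Function using (_∘_)
open import Function.Bundles using (_↔_; _⇔_; Inverse)
open import Level using (0ℓ)
open import Relation.Binary using (Rel; Symmetric; Irreflexive)
import Relation.Binary as B
open import Relation.Binary.Construct.Closure.ReflexiveTransitive using (Star)
open import Relation.Binary.PropositionalEquality
  using (_≡_; _≢_; refl; sym; trans; cong; subst)
open import Relation.Nullary using (¬_; Dec; yes; no; ¬?; contradiction)
open import Relation.Nullary.Decidable using (map′; _×-dec_; _⊎-dec_; _→-dec_; decidable-stable)
open import Relation.Unary using (Pred; Decidable)

------------------------------------------------------------------------
-- Graphs

record Graph (n : ℕ) : Set₁ where
  field
    Adj    : Rel (Fin n) 0ℓ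
    adj?   : B.Decidable Adj
    symm   : Symmetric Adj
    irrefl : Irreflexive _≡_ Adj

open Graph public

∁ : ∀ {n} → Graph n → Graph n
∁ G .Adj u v             = u ≢ v × ¬ Adj G u v
∁ G .adj? u v            = ¬? (u ≟ v) ×-dec ¬? (adj? G u v)
∁ G .symm (u≢v , ¬uv)    = u≢v ∘ sym , ¬uv ∘ symm G
∁ G .irrefl u≡v (u≢v , _) = u≢v u≡v

HasEdge : ∀ {n} → Graph n → Set
HasEdge G = ∃[ u ] ∃[ v ] Adj G u v

-- The order is not required to be positive; this is only used for graphs
-- with an edge.
Connected : ∀ {n} → Graph n → Set
Connected G = ∀ u v → Star (Adj G) u v

_≅_ : ∀ {m n} → Graph m → Graph n → Set
_≅_ {m} {n} G H =
  Σ (Fin m ↔ Fin n) λ φ → ∀ u v → Adj G u v ⇔ Adj H (Inverse.to φ u) (Inverse.to φ v)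

-- Infinitely many graphs, counted up to isomorphism.
InfinitelyMany : (∀ {n} → Graph n → Set) → Set₁
InfinitelyMany P =
  Σ (ℕ → ∃ Graph) λ 𝒢 →
    (∀ i → P (proj₂ (𝒢 i))) × (∀ i j → proj₂ (𝒢 i) ≅ proj₂ (𝒢 j) → i ≡ j)

------------------------------------------------------------------------
-- Standard zero forcing

-- When exactly the vertices of F are filled, v can force w.
Forces : ∀ {n} → Graph n → Pred (Fin n) 0ℓ → Rel (Fin n) 0ℓ
Forces G F v w = F v × Adj G v w × ¬ F w × (∀ u → Adj G v u → ¬ F u → u ≡ w)

-- Filled G B i is the set B^[i].
Filled : ∀ {n} → Graph n → Subset n → ℕ → Pred (Fin n) 0ℓ
Filled G B zero    w = w ∈ B
Filled G B (suc i) w = Filled G B i w ⊎ ∃[ v ] Forces G (Filled G B i) v w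

AllFilled : ∀ {n} → Graph n → Subset n → Pred ℕ 0ℓ
AllFilled G B t = ∀ w → Filled G B t w

------------------------------------------------------------------------
-- Propagation time and throttling

Least : Pred ℕ 0ℓ → Pred ℕ 0ℓ
Least P m = P m × (∀ j → P j → m ≤ j)

-- Each propagation time takes values in ℕ ∪ {∞} and is given by its graph:
-- "IsPt… t" says that the value is the natural number t, and the value is ∞
-- when no such t exists.  Infinite values never affect the minima below.

-- pt_Z(G;B) = t
IsPt : ∀ {n} → Graph n → Subset n → Pred ℕ 0ℓ
IsPt G B = Least (AllFilled G B)

-- pt_Z(G,k) = p
IsPtₖ : ∀ {n} → Graph n → ℕ → Pred ℕ 0ℓ
IsPtₖ G k = Least (λ t → ∃[ B ] ∣ B ∣ ≡ k × IsPt G B t)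

Product : ∀ {n} → Graph n → Pred ℕ 0ℓ
Product {n} G m = ∃[ k ] ∃[ p ] 1 ≤ k × k ≤ n ∸ 1 × IsPtₖ G k p × m ≡ k * p

-- th*_Z(G) = m
IsTh* : ∀ {n} → Graph n → Pred ℕ 0ℓ
IsTh* G = Least (Product G)

------------------------------------------------------------------------
-- th*_Z(G) is a well-defined natural number when G has an edge

Least-unique : ∀ {P a b} → Least P a → Least P b → a ≡ b
Least-unique (Pa , a≤) (Pb , b≤) = ℕ.≤-antisym (a≤ _ Pb) (b≤ _ Pa)

least? : ∀ {P} → Decidable P → Decidable (Least P)
least? {P} P? m = P? m ×-dec map′ to from (ℕ.allUpTo? (¬? ∘ P?) m)
  where
  to : (∀ {j} → j < m → ¬ P j) → ∀ j → P j → m ≤ j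
  to h j Pj with m ≤? j
  ... | yes m≤j = m≤j
  ... | no  m≰j = contradiction Pj (h (ℕ.≰⇒> m≰j))
  from : (∀ j → P j → m ≤ j) → ∀ {j} → j < m → ¬ P j
  from h j<m Pj = ℕ.<⇒≱ j<m (h _ Pj)

least-exists : ∀ {P} → Decidable P → ∀ {m} → P m → ∃ (Least P)
least-exists P? {zero}  P0 = 0 , P0 , λ _ _ → z≤n
least-exists {P} P? {suc m} Pm with P? 0
... | yes P0 = 0 , P0 , λ _ _ → z≤n
... | no ¬P0 with least-exists {P ∘ suc} (P? ∘ suc) Pm
...   | l , Pl , l≤ = suc l , Pl , min
  where
  min : ∀ j → P j → suc l ≤ j
  min zero    P0 = contradiction P0 ¬P0
  min (suc j) Pj = s≤s (l≤ j Pj)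

module _ {n} (G : Graph n) where

  filled? : ∀ B i → Decidable (Filled G B i)
  filled? B zero    w = w ∈? B
  filled? B (suc i) w = F? w ⊎-dec any? λ v →
    F? v ×-dec adj? G v w ×-dec ¬? (F? w) ×-dec
    all? (λ u → adj? G v u →-dec ¬? (F? u) →-dec u ≟ w)
    where
    F? : Decidable (Filled G B i)
    F? = filled? B i

  isPt? : ∀ B → Decidable (IsPt G B)
  isPt? B = least? λ t → all? (filled? B t)

  ptₖ? : ∀ k → Decidable (λ t → ∃[ B ] ∣ B ∣ ≡ k × IsPt G B t)
  ptₖ? k t = anySubset? λ B → (∣ B ∣ ≟ℕ k) ×-dec isPt? B t

  isPtₖ? : ∀ k → Decidable (IsPtₖ G k)
  isPtₖ? k = least? (ptₖ? k)

  product? : Decidable (Product G)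
  product? m = map′ to from
    (ℕ.anyUpTo? (λ k → ℕ.anyUpTo? (λ p →
      1 ≤? k ×-dec k ≤? n ∸ 1 ×-dec isPtₖ? k p ×-dec m ≟ℕ k * p) (suc m)) (suc (n ∸ 1)))
    where
    Body : ℕ → ℕ → Set
    Body k p = 1 ≤ k × k ≤ n ∸ 1 × IsPtₖ G k p × m ≡ k * p
    to : (∃[ k ] k < suc (n ∸ 1) × ∃[ p ] p < suc m × Body k p) → Product G m
    to (k , _ , p , _ , b) = k , p , b
    from : Product G m → ∃[ k ] k < suc (n ∸ 1) × ∃[ p ] p < suc m × Body k p
    from (suc k , p , b@(_ , k≤ , _ , m≡)) =
      suc k , s≤s k≤ , p , s≤s (subst (p ≤_) (sym m≡) (ℕ.m≤m+n p (k * p))) , b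

  -- For an edge vw, all vertices but w form a set that fills w in one step.
  product-exists : HasEdge G → ∃ (Product G)
  product-exists (v , w , vw) =
    let p , isp = least-exists (ptₖ? (n ∸ 1)) (B , ∣B∣ , isPt)
    in (n ∸ 1) * p , n ∸ 1 , p , 1≤n∸1 v w v≢w , ℕ.≤-refl , isp , refl
    where
    B : Subset n
    B = ∁ˢ ⁅ w ⁆
    ∣B∣ : ∣ B ∣ ≡ n ∸ 1
    ∣B∣ = trans (∣∁p∣≡n∸∣p∣ ⁅ w ⁆) (cong (n ∸_) (∣⁅x⁆∣≡1 w))
    v≢w : v ≢ w
    v≢w v≡w = irrefl G v≡w vw
    1≤n∸1 : ∀ {n} (v w : Fin n) → v ≢ w → 1 ≤ n ∸ 1
    1≤n∸1 {suc zero}    zero zero v≢w = contradiction refl v≢w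
    1≤n∸1 {suc (suc _)} _    _    _   = s≤s z≤n
    ≢w⇒∈B : ∀ {x} → x ≢ w → x ∈ B
    ≢w⇒∈B x≢w = x∉p⇒x∈∁p (x≢w ∘ x∈⁅y⁆⇒x≡y w)
    w∉B : ¬ w ∈ B
    w∉B w∈B = x∈∁p⇒x∉p w∈B (x∈⁅x⁆ w)
    fills : AllFilled G B 1
    fills x with x ≟ w
    ... | no x≢w   = inj₁ (≢w⇒∈B x≢w)
    ... | yes refl = inj₂ (v , ≢w⇒∈B v≢w , vw , w∉B ,
                           λ u _ u∉B → decidable-stable (u ≟ w) (u∉B ∘ ≢w⇒∈B))
    isPt : IsPt G B 1
    isPt = fills , λ { zero all → ⊥-elim (w∉B (all w)) ; (suc _) _ → s≤s z≤n }

  th*-exists : HasEdge G → ∃ (IsTh* G)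
  th*-exists e = least-exists product? (proj₂ (product-exists e))

-- The value does not depend on the chosen edge, by Least-unique.
th* : ∀ {n} (G : Graph n) → HasEdge G → ℕ
th* G e = proj₁ (th*-exists G e)

th*-spec : ∀ {n} (G : Graph n) (e : HasEdge G) → IsTh* G (th* G e)
th*-spec G e = proj₂ (th*-exists G e)

------------------------------------------------------------------------
-- Sharpness of Nordhaus–Gaddum sum bounds

⟦_⟧ : ℕ → ℚ
⟦ m ⟧ = + m / 1

-- The bound b on ζ(G) + ζ(∁ G) is almost sharp in the class 𝒞, for a
-- parameter ζ defined on graphs with an edge.
AlmostSharp : (𝒞 : ∀ {n} → Graph n → Set)
              (ζ : ∀ {n} (G : Graph n) → HasEdge G → ℕ) → (ℕ → ℚ) → Set₁
AlmostSharp 𝒞 ζ b =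
  ∃[ k ] 0 < k × k < 10 × InfinitelyMany λ {n} G →
    𝒞 G × ∃[ e ] ∃[ e′ ]
      (⟦ ζ G e +ℕ ζ (∁ G) e′ ⟧ ≡ b n + ⟦ k ⟧ ⊎ ⟦ ζ G e +ℕ ζ (∁ G) e′ ⟧ ≡ b n - ⟦ k ⟧)

-- 5n/4 − 2
lowerBound : ℕ → ℚ
lowerBound n = + (5 * n) / 4 - ⟦ 2 ⟧

{-# OPTIONS --safe #-}
module Submission where

-- Call vertices v₁ … v_s, w₁ … w_s with v_i adjacent to w_j exactly when i = j a
-- matching of size s.  The vertices filled in one step, together with vertices
-- forcing them, form a matching, and no step fills more vertices than there were
-- initially; hence th*(G) ≥ n − s for some matching of G.  Conversely, filling
-- everything but the w_i shows th*(G) ≤ n − s.  It remains to see that matchings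
-- (V , W) of G and (X , Y) of its complement satisfy 4 (s + t) ≤ 3 n + 8: if V meets
-- X then W ∩ Y has at most two vertices, and likewise for the other three pairs.
-- This makes the intersection of V ∪ W and X ∪ Y have at most n / 2 + 4 vertices.
-- The corona of K_{r,r} minus a perfect matching has n = 4 r, with largest matchings
-- of sizes 2 r and, in the complement, r.

open import Defs
open import Data.Empty using (⊥-elim)
import Data.Empty as Empty
open import Data.Fin using (Fin; zero; suc; _≟_; splitAt; _↑ˡ_; _↑ʳ_; remQuot; combine)
open import Data.Fin.Properties using (all?; suc-injective; 0≢1+n; splitAt-↑ˡ; splitAt-↑ʳ; splitAt⁻¹-↑ˡ; splitAt⁻¹-↑ʳ; ↑ˡ-injective; ↑ʳ-injective; remQuot-combine; combine-remQuot)
open import Data.Fin.Permutation using (↔⇒≡)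
open import Data.Fin.Subset using (Subset; inside; outside; ∣_∣; _∈_; _∉_; _⊆_; ⁅_⁆; ⊥; ⊤; _∩_; _∪_; Nonempty)
  renaming (∁ to ∁ˢ)
open import Data.Fin.Subset.Properties
open import Data.Nat using (ℕ; zero; suc; _+_; _*_; _∸_; _<_; z≤n; s≤s) renaming (_≤_ to _≤ℕ_)
import Data.Integer as ℤ
import Data.Integer.Properties as ℤ
import Data.Nat.Properties as ℕ
open import Data.Nat.Tactic.RingSolver using (solve-∀)
open import Data.Product using (∃; ∃-syntax; _×_; _,_; proj₁; proj₂; uncurry)
open import Data.Rational using (_≤_)
import Data.Rational as ℚ
import Data.Rational.Properties as ℚ
open import Algebra.Properties.Group ℚ.+-0-group using (//-rightDividesˡ; //-rightDividesʳ)
open import Data.Rational.Unnormalised using (mkℚᵘ; *≡*; *≤*)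
import Data.Rational.Unnormalised as ℚᵘ
import Data.Rational.Unnormalised.Properties as ℚᵘ
open import Data.Sum using (_⊎_; inj₁; inj₂; [_,_]′)
open import Data.Vec using ([]; _∷_; here; there; tabulate)
open import Data.Vec.Properties using (lookup∘tabulate; lookup⇒[]=; []=⇒lookup)
open import Function using (_∘_; id)
open import Level using (0ℓ)
open import Relation.Binary.Construct.Closure.ReflexiveTransitive using (Star; ε; _◅_; _◅◅_; gmap; reverse)
open import Relation.Binary.PropositionalEquality
  using (_≡_; _≢_; refl; sym; trans; cong; cong₂; subst; subst₂)
open import Relation.Nullary using (¬_; Dec; yes; no; does; contradiction)
open import Relation.Nullary.Decidable using (decidable-stable; dec-true; ¬?; _×-dec_)
open import Relation.Unary using (Pred; Decidable)

private
  variable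
    n s t : ℕ

-- Cardinalities of subsets

⟪_⟫ : {P : Pred (Fin n) 0ℓ} → Decidable P → Subset n
⟪ P? ⟫ = tabulate (does ∘ P?)

∈⟪⟫⁺ : {P : Pred (Fin n) 0ℓ} (P? : Decidable P) {x : Fin n} → P x → x ∈ ⟪ P? ⟫
∈⟪⟫⁺ P? {x} Px =
  lookup⇒[]= x _ (trans (lookup∘tabulate (does ∘ P?) x) (dec-true (P? x) Px))

∈⟪⟫⁻ : {P : Pred (Fin n) 0ℓ} (P? : Decidable P) {x : Fin n} → x ∈ ⟪ P? ⟫ → P x
∈⟪⟫⁻ P? {x} x∈ with P? x | trans (sym (lookup∘tabulate (does ∘ P?) x)) ([]=⇒lookup x∈)
... | yes Px | _ = Px
... | no _   | ()

∣p∪q∣+∣p∩q∣≡∣p∣+∣q∣ : (p q : Subset n) → ∣ p ∪ q ∣ + ∣ p ∩ q ∣ ≡ ∣ p ∣ + ∣ q ∣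
∣p∪q∣+∣p∩q∣≡∣p∣+∣q∣ []            []            = refl
∣p∪q∣+∣p∩q∣≡∣p∣+∣q∣ (outside ∷ p) (outside ∷ q) = ∣p∪q∣+∣p∩q∣≡∣p∣+∣q∣ p q
∣p∪q∣+∣p∩q∣≡∣p∣+∣q∣ (inside  ∷ p) (outside ∷ q) = cong suc (∣p∪q∣+∣p∩q∣≡∣p∣+∣q∣ p q)
∣p∪q∣+∣p∩q∣≡∣p∣+∣q∣ (outside ∷ p) (inside  ∷ q) =
  trans (cong suc (∣p∪q∣+∣p∩q∣≡∣p∣+∣q∣ p q)) (sym (ℕ.+-suc ∣ p ∣ ∣ q ∣))
∣p∪q∣+∣p∩q∣≡∣p∣+∣q∣ (inside  ∷ p) (inside  ∷ q) = cong suc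
  (trans (ℕ.+-suc ∣ p ∪ q ∣ ∣ p ∩ q ∣)
  (trans (cong suc (∣p∪q∣+∣p∩q∣≡∣p∣+∣q∣ p q)) (sym (ℕ.+-suc ∣ p ∣ ∣ q ∣))))

∣p∪q∣≤∣p∣+∣q∣ : (p q : Subset n) → ∣ p ∪ q ∣ ≤ℕ ∣ p ∣ + ∣ q ∣
∣p∪q∣≤∣p∣+∣q∣ p q = subst (∣ p ∪ q ∣ ≤ℕ_) (∣p∪q∣+∣p∩q∣≡∣p∣+∣q∣ p q) (ℕ.m≤m+n _ _)

Disjoint : Subset n → Subset n → Set
Disjoint p q = ∀ {x} → x ∈ p → x ∉ q

∣empty∣≡0 : {p : Subset n} → (∀ {x} → x ∉ p) → ∣ p ∣ ≡ 0
∣empty∣≡0 {n} x∉p = trans (cong ∣_∣ (Empty-unique λ (_ , x∈p) → x∉p x∈p)) (∣⊥∣≡0 n)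

∣p∪q∣≡∣p∣+∣q∣ : (p q : Subset n) → Disjoint p q → ∣ p ∪ q ∣ ≡ ∣ p ∣ + ∣ q ∣
∣p∪q∣≡∣p∣+∣q∣ p q p#q = trans (sym (ℕ.+-identityʳ _))
  (trans (cong (∣ p ∪ q ∣ +_) (sym (∣empty∣≡0 λ x∈ → let x∈p , x∈q = x∈p∩q⁻ p q x∈ in p#q x∈p x∈q)))
         (∣p∪q∣+∣p∩q∣≡∣p∣+∣q∣ p q))

disjoint-⊆⇒∣p∣+∣q∣≤∣r∣ : {p q r : Subset n} → Disjoint p q → p ⊆ r → q ⊆ r → ∣ p ∣ + ∣ q ∣ ≤ℕ ∣ r ∣
disjoint-⊆⇒∣p∣+∣q∣≤∣r∣ {p = p} {q} {r} p#q p⊆r q⊆r =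
  subst (_≤ℕ ∣ r ∣) (∣p∪q∣≡∣p∣+∣q∣ p q p#q)
    (p⊆q⇒∣p∣≤∣q∣ λ x∈ → [ p⊆r , q⊆r ]′ (x∈p∪q⁻ p q x∈))

empty⊎nonempty : (p : Subset n) → ∣ p ∣ ≡ 0 ⊎ Nonempty p
empty⊎nonempty p with nonempty? p
... | yes ne = inj₂ ne
... | no ¬ne = inj₁ (∣empty∣≡0 (λ {x} x∈p → ¬ne (x , x∈p)))

image : (Fin s → Fin n) → Subset n
image {zero}  f = ⊥
image {suc s} f = ⁅ f zero ⁆ ∪ image (f ∘ suc)

∈image⁺ : (f : Fin s → Fin n) (i : Fin s) → f i ∈ image f
∈image⁺ f zero    = x∈p∪q⁺ (inj₁ (x∈⁅x⁆ (f zero)))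
∈image⁺ f (suc i) = x∈p∪q⁺ {p = ⁅ f zero ⁆} (inj₂ (∈image⁺ (f ∘ suc) i))

∈image⁻ : (f : Fin s → Fin n) {x : Fin n} → x ∈ image f → ∃[ i ] f i ≡ x
∈image⁻ {zero}  f x∈ = contradiction x∈ ∉⊥
∈image⁻ {suc s} f x∈ with x∈p∪q⁻ ⁅ f zero ⁆ (image (f ∘ suc)) x∈
... | inj₁ x∈⁅⁆ = zero , sym (x∈⁅y⁆⇒x≡y (f zero) x∈⁅⁆)
... | inj₂ x∈′  = let i , fi≡x = ∈image⁻ (f ∘ suc) x∈′ in suc i , fi≡x

∣image∣ : (f : Fin s → Fin n) → (∀ {i j} → f i ≡ f j → i ≡ j) → ∣ image f ∣ ≡ s
∣image∣ {zero}  {n} f inj = ∣⊥∣≡0 n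
∣image∣ {suc s} f inj =
  trans (∣p∪q∣≡∣p∣+∣q∣ ⁅ f zero ⁆ (image (f ∘ suc)) fresh)
        (cong₂ _+_ (∣⁅x⁆∣≡1 (f zero)) (∣image∣ (f ∘ suc) (suc-injective ∘ inj)))
  where
  fresh : Disjoint ⁅ f zero ⁆ (image (f ∘ suc))
  fresh x∈⁅⁆ x∈ with refl ← x∈⁅y⁆⇒x≡y (f zero) x∈⁅⁆
                   | i , eq ← ∈image⁻ (f ∘ suc) x∈ = contradiction (inj (sym eq)) 0≢1+n

enumerate : (p : Subset n) → Fin ∣ p ∣ → Fin n
enumerate (inside  ∷ p) zero    = zero
enumerate (inside  ∷ p) (suc i) = suc (enumerate p i)
enumerate (outside ∷ p) i       = suc (enumerate p i)

enumerate-∈ : (p : Subset n) (i : Fin ∣ p ∣) → enumerate p i ∈ p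
enumerate-∈ (inside  ∷ p) zero    = here
enumerate-∈ (inside  ∷ p) (suc i) = there (enumerate-∈ p i)
enumerate-∈ (outside ∷ p) i       = there (enumerate-∈ p i)

enumerate-injective : (p : Subset n) {i j : Fin ∣ p ∣} → enumerate p i ≡ enumerate p j → i ≡ j
enumerate-injective (inside  ∷ p) {zero}  {zero}  _  = refl
enumerate-injective (inside  ∷ p) {suc i} {suc j} eq =
  cong suc (enumerate-injective p (suc-injective eq))
enumerate-injective (outside ∷ p) eq = enumerate-injective p (suc-injective eq)

-- Cross-induced matchings

-- Only adjacencies between the two sides are constrained; edges inside a side are free. Injectivity
-- of `v` and `w` follows from `matched` and `induced`, whereas `disjoint` does not: the middle of a
-- path could be both `v i` and `w j`.
record Matching (G : Graph n) (s : ℕ) : Set where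
  field
    v w      : Fin s → Fin n
    matched  : ∀ i → Adj G (v i) (w i)
    induced  : ∀ {i j} → Adj G (v i) (w j) → i ≡ j
    disjoint : ∀ i j → v i ≢ w j

  v-injective : ∀ {i j} → v i ≡ v j → i ≡ j
  v-injective {i} {j} eq = sym (induced (subst (λ u → Adj G u (w i)) eq (matched i)))

  w-injective : ∀ {i j} → w i ≡ w j → i ≡ j
  w-injective {i} {j} eq = induced (subst (Adj G (v i)) eq (matched i))

  V W : Subset n
  V = image v
  W = image w

  ∣V∣ : ∣ V ∣ ≡ s
  ∣V∣ = ∣image∣ v v-injective

  ∣W∣ : ∣ W ∣ ≡ s
  ∣W∣ = ∣image∣ w w-injective

  V#W : Disjoint V W
  V#W x∈V x∈W with i , refl ← ∈image⁻ v x∈V | j , eq ← ∈image⁻ w x∈W = disjoint i j (sym eq)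

  s+s≤n : s + s ≤ℕ n
  s+s≤n = subst (_≤ℕ n) (trans (∣p∪q∣≡∣p∣+∣q∣ V W V#W) (cong₂ _+_ ∣V∣ ∣W∣)) (∣p∣≤n (V ∪ W))

swap : {G : Graph n} → Matching G s → Matching G s
swap {G = G} M = record
  { v = w ; w = v ; matched = λ i → symm G (matched i)
  ; induced = λ a → sym (induced (symm G a)) ; disjoint = λ i j eq → disjoint j i (sym eq) }
  where open Matching M

-- The layers of a zero forcing process

module Layers (G : Graph n) (B : Subset n) where

  F? : ∀ t → Decidable (Filled G B t)
  F? = filled? G B

  filledSet : ℕ → Subset n
  filledSet t = ⟪ F? t ⟫

  new? : ∀ t → Decidable (λ x → Filled G B (suc t) x × ¬ Filled G B t x)
  new? t x = F? (suc t) x ×-dec ¬? (F? t x)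

  layer : ℕ → Subset n
  layer t = ⟪ new? t ⟫

  forcer : ∀ t {x} → x ∈ layer t → ∃[ v ] Forces G (Filled G B t) v x
  forcer t x∈ with ∈⟪⟫⁻ (new? t) x∈
  ... | inj₁ old , ¬old = contradiction old ¬old
  ... | inj₂ f   , _    = f

  -- A forcer has just one unfilled neighbour, so it is adjacent to no other vertex of the layer. At
  -- time `t` the forcers are filled and the layer is not.
  layerMatching : ∀ t → Matching G ∣ layer t ∣
  layerMatching t = record
    { v = proj₁ ∘ f
    ; w = e
    ; matched = λ i → let _ , _ , a , _ = f i in a
    ; induced = λ {i} {j} a → let _ , _ , _ , _ , unique = f i in
        enumerate-injective (layer t) (sym (unique (e j) a (unfilled j)))
    ; disjoint = λ i j eq → let _ , Fv , _ = f i in unfilled j (subst (Filled G B t) eq Fv)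
    }
    where
    e = enumerate (layer t)
    f = λ i → forcer t (enumerate-∈ (layer t) i)
    unfilled : ∀ j → ¬ Filled G B t (e j)
    unfilled j = proj₂ (∈⟪⟫⁻ (new? t) (enumerate-∈ (layer t) j))

  filledSet-suc : ∀ t → ∣ filledSet (suc t) ∣ ≤ℕ ∣ filledSet t ∣ + ∣ layer t ∣
  filledSet-suc t = ℕ.≤-trans (p⊆q⇒∣p∣≤∣q∣ sub) (∣p∪q∣≤∣p∣+∣q∣ (filledSet t) (layer t))
    where
    sub : filledSet (suc t) ⊆ filledSet t ∪ layer t
    sub {x} x∈ with F? t x
    ... | yes Fx = x∈p∪q⁺ (inj₁ (∈⟪⟫⁺ (F? t) Fx))
    ... | no ¬Fx = x∈p∪q⁺ {p = filledSet t}
                     (inj₂ (∈⟪⟫⁺ (new? t) (∈⟪⟫⁻ (F? (suc t)) x∈ , ¬Fx)))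

  -- Filled vertices outside this set can no longer force.
  Active : ℕ → Pred (Fin n) 0ℓ
  Active t x = Filled G B t x × ∃[ u ] Adj G x u × ¬ Filled G B t u

  -- A vertex that forces has no unfilled neighbour left, so replacing the
  -- forcers by the vertices they fill keeps the active vertices covered.
  activeCover : ∀ t → ∃[ A ] ∣ A ∣ ≤ℕ ∣ B ∣ × (∀ {x} → Active t x → x ∈ A)
  layer-≤ : ∀ t → ∣ layer t ∣ ≤ℕ ∣ B ∣

  -- A forcer is active because the vertex it forces is an unfilled neighbour. The proof is mutual
  -- with `activeCover`, whose next stage discards these forcers.
  V⊆cover : ∀ t → Matching.V (layerMatching t) ⊆ proj₁ (activeCover t)
  V⊆cover t x∈V with i , refl ← ∈image⁻ (Matching.v (layerMatching t)) x∈V =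
    let x∈ = enumerate-∈ (layer t) i
        _ , Fv , a , ¬Fw , _ = forcer t x∈
    in proj₂ (proj₂ (activeCover t)) (Fv , _ , a , ¬Fw)

  activeCover zero    = B , ℕ.≤-refl , proj₁
  activeCover (suc t) = A′ , ℕ.≤-trans ∣A′∣≤∣A∣ ∣A∣≤ , covers
    where
    open Matching (layerMatching t) using (V; ∣V∣)
    A = proj₁ (activeCover t)
    ∣A∣≤ = proj₁ (proj₂ (activeCover t))
    A′ = (A ∩ ∁ˢ V) ∪ layer t
    ∣A′∣≤∣A∣ : ∣ A′ ∣ ≤ℕ ∣ A ∣
    ∣A′∣≤∣A∣ = begin
      ∣ A′ ∣                        ≤⟨ ∣p∪q∣≤∣p∣+∣q∣ (A ∩ ∁ˢ V) (layer t) ⟩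
      ∣ A ∩ ∁ˢ V ∣ + ∣ layer t ∣    ≡⟨ cong (∣ A ∩ ∁ˢ V ∣ +_) ∣V∣ ⟨
      ∣ A ∩ ∁ˢ V ∣ + ∣ V ∣          ≤⟨ disjoint-⊆⇒∣p∣+∣q∣≤∣r∣
                                         (λ x∈ → x∈∁p⇒x∉p (proj₂ (x∈p∩q⁻ A (∁ˢ V) x∈)))
                                         (p∩q⊆p A (∁ˢ V)) (V⊆cover t) ⟩
      ∣ A ∣                         ∎
      where open ℕ.≤-Reasoning
    covers : ∀ {x} → Active (suc t) x → x ∈ A′
    covers {x} (Fx , u , xu , ¬Fu) with F? t x
    ... | no ¬Fx′ = x∈p∪q⁺ {p = A ∩ ∁ˢ V} (inj₂ (∈⟪⟫⁺ (new? t) (Fx , ¬Fx′)))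
    ... | yes Fx′ = x∈p∪q⁺ (inj₁ (x∈p∩q⁺
          (proj₂ (proj₂ (activeCover t)) (Fx′ , u , xu , ¬Fu ∘ inj₁) , x∉p⇒x∈∁p x∉V)))
      where
      x∉V : x ∉ V
      -- A neighbour unfilled after the step was unfilled before it, hence is the forced vertex,
      -- which is filled by now.
      x∉V x∈V with i , refl ← ∈image⁻ (Matching.v (layerMatching t)) x∈V =
        let x∈ = enumerate-∈ (layer t) i
            _ , _ , _ , _ , unique = forcer t x∈
        in ¬Fu (subst (Filled G B (suc t)) (sym (unique u xu (¬Fu ∘ inj₁)))
                 (proj₁ (∈⟪⟫⁻ (new? t) x∈)))

  layer-≤ t = begin
    ∣ layer t ∣                           ≡⟨ Matching.∣V∣ (layerMatching t) ⟨
    ∣ Matching.V (layerMatching t) ∣      ≤⟨ p⊆q⇒∣p∣≤∣q∣ (V⊆cover t) ⟩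
    ∣ proj₁ (activeCover t) ∣             ≤⟨ proj₁ (proj₂ (activeCover t)) ⟩
    ∣ B ∣                                 ∎
    where open ℕ.≤-Reasoning

  -- Keeps a largest layer so far: its size bounds each of the first `t` layers, so one matching
  -- controls the whole process.
  largestLayer : ∀ t → ∃[ s ] Matching G s × s ≤ℕ ∣ B ∣ × ∣ filledSet t ∣ ≤ℕ ∣ B ∣ + t * s
  largestLayer zero = 0 , empty , z≤n , ℕ.≤-trans (p⊆q⇒∣p∣≤∣q∣ (∈⟪⟫⁻ (F? 0))) (ℕ.m≤m+n _ _)
    where
    empty : Matching G 0
    empty = record { v = λ () ; w = λ () ; matched = λ () ; induced = λ { {()} } ; disjoint = λ () }
  largestLayer (suc t) with largestLayer t
  ... | s , M , s≤ , ∣F∣≤ = [ (λ ℓ≤s → s , M , s≤ , bound ℕ.≤-refl ℓ≤s)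
                            , (λ s≤ℓ → _ , layerMatching t , layer-≤ t , bound s≤ℓ ℕ.≤-refl)
                            ]′ (ℕ.≤-total ∣ layer t ∣ s)
    where
    bound : ∀ {m} → s ≤ℕ m → ∣ layer t ∣ ≤ℕ m → ∣ filledSet (suc t) ∣ ≤ℕ ∣ B ∣ + suc t * m
    bound {m} s≤m ℓ≤m = begin
      ∣ filledSet (suc t) ∣             ≤⟨ filledSet-suc t ⟩
      ∣ filledSet t ∣ + ∣ layer t ∣     ≤⟨ ℕ.+-mono-≤ ∣F∣≤ ℓ≤m ⟩
      ∣ B ∣ + t * s + m                 ≤⟨ ℕ.+-monoˡ-≤ m (ℕ.+-monoʳ-≤ ∣ B ∣ (ℕ.*-monoʳ-≤ t s≤m)) ⟩
      ∣ B ∣ + t * m + m                 ≡⟨ rearrange ∣ B ∣ t m ⟩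
      ∣ B ∣ + suc t * m                 ∎
      where
      open ℕ.≤-Reasoning
      rearrange : ∀ b t s → b + t * s + s ≡ b + (s + t * s)
      rearrange = solve-∀

-- The throttling number in terms of matchings

-- k vertices filling everything in p steps, at most s ≤ k of them per step.
k+ps≤kp+s : ∀ k p s → 1 ≤ℕ p → s ≤ℕ k → k + p * s ≤ℕ k * p + s
k+ps≤kp+s k (suc p) s _ s≤k = begin
  k + (s + p * s)   ≡⟨ lhs k p s ⟩
  k + s + p * s     ≤⟨ ℕ.+-monoʳ-≤ (k + s) (ℕ.*-monoʳ-≤ p s≤k) ⟩
  k + s + p * k     ≡⟨ rhs k p s ⟩
  k * suc p + s     ∎
  where
  open ℕ.≤-Reasoning
  lhs : ∀ k p s → k + (s + p * s) ≡ k + s + p * s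
  lhs = solve-∀
  rhs : ∀ k p s → k + s + p * k ≡ k * (1 + p) + s
  rhs = solve-∀

-- Filling everything in `p` steps from `k` vertices gives n ≤ k + p s, which s ≤ k turns into n ≤ k
-- p + s.
product⇒matching : (G : Graph n) {m : ℕ} → Product G m → ∃[ s ] Matching G s × n ≤ℕ m + s
-- Zero steps would mean that all `n` vertices are filled at the start, against `k ≤ n ∸ 1`.
product⇒matching {n} G (_ , zero , 1≤k , k≤ , ((B , refl , all , _) , _) , refl) =
  contradiction (ℕ.≤-trans n≤∣B∣ k≤) (ℕ.<⇒≱ (pred-< n (ℕ.≤-trans 1≤k k≤)))
  where
  n≤∣B∣ : n ≤ℕ ∣ B ∣
  n≤∣B∣ = subst (_≤ℕ ∣ B ∣) (∣⊤∣≡n n) (p⊆q⇒∣p∣≤∣q∣ {p = ⊤} (λ {x} _ → all x))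
  pred-< : ∀ n → 1 ≤ℕ n ∸ 1 → n ∸ 1 < n
  pred-< (suc n) _ = ℕ.≤-refl
product⇒matching {n} G (_ , p@(suc _) , 1≤k , k≤ , ((B , refl , all , _) , _) , refl) =
  let s , M , s≤ , ∣F∣≤ = largestLayer p
  in s , M , (begin
    n                     ≡⟨ ∣⊤∣≡n n ⟨
    ∣ ⊤ {n} ∣             ≤⟨ p⊆q⇒∣p∣≤∣q∣ {p = ⊤} (λ {x} _ → ∈⟪⟫⁺ (F? p) (all x)) ⟩
    ∣ filledSet p ∣       ≤⟨ ∣F∣≤ ⟩
    ∣ B ∣ + p * s         ≤⟨ k+ps≤kp+s ∣ B ∣ p s (s≤s z≤n) s≤ ⟩
    ∣ B ∣ * p + s         ∎)
  where
  open Layers G B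
  open ℕ.≤-Reasoning

th*-≥ : (G : Graph n) {m : ℕ} → IsTh* G m → ∃[ s ] Matching G s × n ≤ℕ m + s
th*-≥ G (P , _) = product⇒matching G P

-- Filling all but `W` takes one step, as `w i` is the only unfilled neighbour of `v i`. The size is
-- `suc s` because an admissible set omits at least one vertex.
th*-≤ : (G : Graph n) {m : ℕ} → IsTh* G m → Matching G (suc s) → m ≤ℕ n ∸ suc s
th*-≤ {n} {s} G {m} (_ , least) M =
  -- `IsPtₖ` asks for exact minima: `q` is the propagation time of `B`, and `p` the best over all
  -- sets of that size, so both are at most 1.
  let q , isq           = least-exists (λ t → all? (filled? G B t)) {1} fills
      p , isp           = least-exists (ptₖ? G (n ∸ suc s)) (B , ∣B∣ , isq)
      p≤1 = ℕ.≤-trans (proj₂ isp q (B , ∣B∣ , isq)) (proj₂ isq 1 fills)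
  in begin
    m                   ≤⟨ least _ (n ∸ suc s , p , 1≤ , ℕ.∸-monoʳ-≤ n (s≤s z≤n) , isp , refl) ⟩
    (n ∸ suc s) * p     ≤⟨ ℕ.*-monoʳ-≤ (n ∸ suc s) p≤1 ⟩
    (n ∸ suc s) * 1     ≡⟨ ℕ.*-identityʳ _ ⟩
    n ∸ suc s           ∎
  where
  open Matching M
  open ℕ.≤-Reasoning
  B : Subset n
  B = ∁ˢ W
  ∣B∣ : ∣ B ∣ ≡ n ∸ suc s
  ∣B∣ = trans (∣∁p∣≡n∸∣p∣ W) (cong (n ∸_) ∣W∣)
  1≤ : 1 ≤ℕ n ∸ suc s
  1≤ = ℕ.≤-trans (s≤s z≤n) (ℕ.m+n≤o⇒m≤o∸n (suc s) s+s≤n)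
  fills : AllFilled G B 1
  fills x with x ∈? B
  ... | yes x∈B = inj₁ x∈B
  ... | no  x∉B with i , refl ← ∈image⁻ w (x∉∁p⇒x∈p x∉B) =
    inj₂ (v i , x∉p⇒x∈∁p (V#W (∈image⁺ v i)) , matched i , x∉B , unique)
    where
    unique : ∀ u → Adj G (v i) u → u ∉ B → u ≡ w i
    unique u vu u∉B with j , refl ← ∈image⁻ w (x∉∁p⇒x∈p u∉B) = cong w (sym (induced vu))

-- A matching of a graph and a matching of its complement

module _ (G : Graph n) (M : Matching G s) (N : Matching (∁ G) t) where
  private
    module M = Matching M
    module N = Matching N

  -- A vertex of V ∩ X is adjacent to one vertex of W and to all but one of Y.
  ∣W∩Y∣≤2 : Nonempty (M.V ∩ N.V) → ∣ M.W ∩ N.W ∣ ≤ℕ 2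
  ∣W∩Y∣≤2 (u , u∈) = begin
    ∣ M.W ∩ N.W ∣                          ≤⟨ p⊆q⇒∣p∣≤∣q∣ sub ⟩
    ∣ ⁅ M.w i ⁆ ∪ ⁅ N.w j ⁆ ∣              ≤⟨ ∣p∪q∣≤∣p∣+∣q∣ ⁅ M.w i ⁆ ⁅ N.w j ⁆ ⟩
    ∣ ⁅ M.w i ⁆ ∣ + ∣ ⁅ N.w j ⁆ ∣          ≡⟨ cong₂ _+_ (∣⁅x⁆∣≡1 (M.w i)) (∣⁅x⁆∣≡1 (N.w j)) ⟩
    2                                      ∎
    where
    open ℕ.≤-Reasoning
    u∈V×X = x∈p∩q⁻ M.V N.V u∈
    i = proj₁ (∈image⁻ M.v (proj₁ u∈V×X))
    j = proj₁ (∈image⁻ N.v (proj₂ u∈V×X))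
    vi≡u = proj₂ (∈image⁻ M.v (proj₁ u∈V×X))
    xj≡u = proj₂ (∈image⁻ N.v (proj₂ u∈V×X))
    sub : M.W ∩ N.W ⊆ ⁅ M.w i ⁆ ∪ ⁅ N.w j ⁆
    sub {z} z∈ with z∈W , z∈Y ← x∈p∩q⁻ M.W N.W z∈
               with k , wk≡z ← ∈image⁻ M.w z∈W | l , yl≡z ← ∈image⁻ N.w z∈Y
               with adj? G u z
    ... | yes uz
      with refl ← M.induced {i} {k} (subst (λ x → Adj G x (M.w k)) (sym vi≡u)
                                       (subst (Adj G u) (sym wk≡z) uz))
      = x∈p∪q⁺ (inj₁ (subst (_∈ ⁅ M.w i ⁆) wk≡z (x∈⁅x⁆ _)))
    -- `N.disjoint` supplies the distinctness that adjacency in the complement requires.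
    ... | no ¬uz
      with refl ← N.induced {j} {l} (N.disjoint j l , λ a →
                    ¬uz (subst (λ x → Adj G x z) xj≡u (subst (Adj G (N.v j)) yl≡z a)))
      = x∈p∪q⁺ {p = ⁅ M.w i ⁆} (inj₂ (subst (_∈ ⁅ N.w j ⁆) yl≡z (x∈⁅x⁆ _)))

-- Meant for opposite overlaps such as `V ∩ X` and `W ∩ Y`: if either is nonempty the other has at
-- most two elements, so two nonempty ones total at most four.
0⊎0⊎≤4 : ∀ {a d} → a ≡ 0 ⊎ d ≤ℕ 2 → d ≡ 0 ⊎ a ≤ℕ 2 → a ≡ 0 ⊎ d ≡ 0 ⊎ a + d ≤ℕ 4
0⊎0⊎≤4 (inj₁ a≡0) _          = inj₁ a≡0
0⊎0⊎≤4 (inj₂ _)   (inj₁ d≡0) = inj₂ (inj₁ d≡0)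
0⊎0⊎≤4 (inj₂ d≤2) (inj₂ a≤2) = inj₂ (inj₂ (ℕ.+-mono-≤ a≤2 d≤2))

-- a, b, c, d are the sizes of V ∩ X, V ∩ Y, W ∩ X, W ∩ Y, and m that of their union.
overlap-bound : ∀ {n s t m} a b c d → s + s ≤ℕ n → t + t ≤ℕ n → m ≤ℕ n →
  m ≤ℕ (a + d) + (b + c) → a + b ≤ℕ s → c + d ≤ℕ s → a + c ≤ℕ t → b + d ≤ℕ t →
  a ≡ 0 ⊎ d ≡ 0 ⊎ a + d ≤ℕ 4 → b ≡ 0 ⊎ c ≡ 0 ⊎ b + c ≤ℕ 4 → m + m ≤ℕ n + 8
overlap-bound {n} {s} {t} {m} a b c d 2s≤n 2t≤n m≤n m≤ ab≤s cd≤s ac≤t bd≤t = cases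
  where
  open ℕ.≤-Reasoning
  -- In every case but the last it suffices to bound `m` by `h + 4`, where `h` is `s` or `t`.
  via : ∀ {h} → h + h ≤ℕ n → m ≤ℕ h + 4 → m + m ≤ℕ n + 8
  via {h} 2h≤n m≤h+4 = begin
    m + m                 ≤⟨ ℕ.+-mono-≤ m≤h+4 m≤h+4 ⟩
    (h + 4) + (h + 4)     ≡⟨ eq h ⟩
    (h + h) + 8           ≤⟨ ℕ.+-monoˡ-≤ 8 2h≤n ⟩
    n + 8                 ∎
    where
    eq : ∀ h → (h + 4) + (h + 4) ≡ (h + h) + 8
    eq = solve-∀
  one : ∀ {h} x y → h + h ≤ℕ n → m ≤ℕ x + y → x + y ≤ℕ h → m + m ≤ℕ n + 8
  one x y 2h≤n m≤′ x+y≤h = via 2h≤n (ℕ.≤-trans m≤′ (ℕ.≤-trans x+y≤h (ℕ.m≤m+n _ 4)))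
  four : ∀ {h} x y → h + h ≤ℕ n → m ≤ℕ x + y → x ≤ℕ h → y ≤ℕ 4 → m + m ≤ℕ n + 8
  four x y 2h≤n m≤′ x≤h y≤4 = via 2h≤n (ℕ.≤-trans m≤′ (ℕ.+-mono-≤ x≤h y≤4))
  ad≡ : a + d + (b + c) ≡ b + c + (a + d)
  ad≡ = ℕ.+-comm (a + d) (b + c)
  a≤s = ℕ.≤-trans (ℕ.m≤m+n a b) ab≤s
  b≤s = ℕ.≤-trans (ℕ.m≤n+m b a) ab≤s
  c≤s = ℕ.≤-trans (ℕ.m≤m+n c d) cd≤s
  d≤s = ℕ.≤-trans (ℕ.m≤n+m d c) cd≤s
  -- In the two by two table of overlaps, rows sum to at most `s` and columns to at most `t`. One
  -- empty entry on each diagonal leaves a row or a column; one empty entry and a small other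
  -- diagonal leave a single entry plus four.
  cases : a ≡ 0 ⊎ d ≡ 0 ⊎ a + d ≤ℕ 4 → b ≡ 0 ⊎ c ≡ 0 ⊎ b + c ≤ℕ 4 → m + m ≤ℕ n + 8
  cases (inj₁ refl)        (inj₁ refl)        = one d c 2s≤n m≤ (subst (_≤ℕ s) (ℕ.+-comm c d) cd≤s)
  cases (inj₁ refl)        (inj₂ (inj₁ refl)) = one d (b + 0) 2t≤n m≤
    (subst (_≤ℕ t) (trans (ℕ.+-comm b d) (cong (d +_) (sym (ℕ.+-identityʳ b)))) bd≤t)
  cases (inj₁ refl)        (inj₂ (inj₂ bc≤4)) = four d (b + c) 2s≤n m≤ d≤s bc≤4
  cases (inj₂ (inj₁ refl)) (inj₁ refl)        = one a c 2t≤n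
    (subst (λ x → m ≤ℕ x + c) (ℕ.+-identityʳ a) m≤) ac≤t
  cases (inj₂ (inj₁ refl)) (inj₂ (inj₁ refl)) = one a b 2s≤n
    (subst (m ≤ℕ_) (cong₂ _+_ (ℕ.+-identityʳ a) (ℕ.+-identityʳ b)) m≤) ab≤s
  cases (inj₂ (inj₁ refl)) (inj₂ (inj₂ bc≤4)) = four a (b + c) 2s≤n
    (subst (λ x → m ≤ℕ x + (b + c)) (ℕ.+-identityʳ a) m≤) a≤s bc≤4
  cases (inj₂ (inj₂ ad≤4)) (inj₁ refl)        = four c (a + d) 2s≤n (subst (m ≤ℕ_) ad≡ m≤) c≤s ad≤4
  cases (inj₂ (inj₂ ad≤4)) (inj₂ (inj₁ refl)) = four (b + 0) (a + d) 2s≤n (subst (m ≤ℕ_) ad≡ m≤)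
    (subst (_≤ℕ s) (sym (ℕ.+-identityʳ b)) b≤s) ad≤4
  -- Both diagonals are small, so one copy of `m` is at most 8 and the other is bounded by `n`.
  cases (inj₂ (inj₂ ad≤4)) (inj₂ (inj₂ bc≤4)) =
    ℕ.+-mono-≤ m≤n (ℕ.≤-trans m≤ (ℕ.+-mono-≤ ad≤4 bc≤4))

∣p∩q∣+∣p∩r∣≤∣p∣ : (p q r : Subset n) → Disjoint q r → ∣ p ∩ q ∣ + ∣ p ∩ r ∣ ≤ℕ ∣ p ∣
∣p∩q∣+∣p∩r∣≤∣p∣ p q r q#r = disjoint-⊆⇒∣p∣+∣q∣≤∣r∣
  (λ x∈pq x∈pr → q#r (proj₂ (x∈p∩q⁻ p q x∈pq)) (proj₂ (x∈p∩q⁻ p r x∈pr)))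
  (p∩q⊆p p q) (p∩q⊆p p r)

-- Inclusion-exclusion gives 2 s + 2 t ≤ n + m for the overlap m. Doubling this and inserting 2 m ≤
-- n + 8 yields the bound.
matchings-bound : (G : Graph n) → Matching G s → Matching (∁ G) t →
                  4 * (s + t) ≤ℕ 3 * n + 8
matchings-bound {n} {s} {t} G M N = begin
  4 * (s + t)                                ≡⟨ eq₁ s t ⟩
  ((s + s) + (t + t)) + ((s + s) + (t + t))  ≡⟨ cong₂ _+_ total total ⟨
  (∣ P ∪ Q ∣ + m) + (∣ P ∪ Q ∣ + m)          ≤⟨ ℕ.+-mono-≤ (ℕ.+-monoˡ-≤ m (∣p∣≤n (P ∪ Q)))
                                                           (ℕ.+-monoˡ-≤ m (∣p∣≤n (P ∪ Q))) ⟩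
  (n + m) + (n + m)                          ≡⟨ eq₂ n m ⟩
  n + n + (m + m)                            ≤⟨ ℕ.+-monoʳ-≤ (n + n) 2m≤n+8 ⟩
  n + n + (n + 8)                            ≡⟨ eq₃ n ⟩
  3 * n + 8                                  ∎
  where
  open ℕ.≤-Reasoning
  open Matching M using (V; W) renaming (∣V∣ to ∣V∣≡s; ∣W∣ to ∣W∣≡s; V#W to V#W; s+s≤n to 2s≤n)
  open Matching N using () renaming (V to X; W to Y; ∣V∣ to ∣X∣≡t; ∣W∣ to ∣Y∣≡t; V#W to X#Y; s+s≤n to 2t≤n)
  eq₁ : ∀ s t → 4 * (s + t) ≡ ((s + s) + (t + t)) + ((s + s) + (t + t))
  eq₁ = solve-∀
  eq₂ : ∀ n m → (n + m) + (n + m) ≡ n + n + (m + m)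
  eq₂ = solve-∀
  eq₃ : ∀ n → n + n + (n + 8) ≡ 3 * n + 8
  eq₃ = solve-∀
  P = V ∪ W
  Q = X ∪ Y
  m = ∣ P ∩ Q ∣
  total : ∣ P ∪ Q ∣ + m ≡ (s + s) + (t + t)
  total = trans (∣p∪q∣+∣p∩q∣≡∣p∣+∣q∣ P Q) (cong₂ _+_
    (trans (∣p∪q∣≡∣p∣+∣q∣ V W V#W) (cong₂ _+_ ∣V∣≡s ∣W∣≡s))
    (trans (∣p∪q∣≡∣p∣+∣q∣ X Y X#Y) (cong₂ _+_ ∣X∣≡t ∣Y∣≡t)))
  m≤ : m ≤ℕ (∣ V ∩ X ∣ + ∣ W ∩ Y ∣) + (∣ V ∩ Y ∣ + ∣ W ∩ X ∣)
  m≤ = begin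
    m                                                   ≤⟨ p⊆q⇒∣p∣≤∣q∣ sub ⟩
    ∣ (V ∩ X ∪ W ∩ Y) ∪ (V ∩ Y ∪ W ∩ X) ∣               ≤⟨ ∣p∪q∣≤∣p∣+∣q∣ (V ∩ X ∪ W ∩ Y) (V ∩ Y ∪ W ∩ X) ⟩
    ∣ V ∩ X ∪ W ∩ Y ∣ + ∣ V ∩ Y ∪ W ∩ X ∣               ≤⟨ ℕ.+-mono-≤ (∣p∪q∣≤∣p∣+∣q∣ (V ∩ X) (W ∩ Y))
                                                                      (∣p∪q∣≤∣p∣+∣q∣ (V ∩ Y) (W ∩ X)) ⟩
    (∣ V ∩ X ∣ + ∣ W ∩ Y ∣) + (∣ V ∩ Y ∣ + ∣ W ∩ X ∣)   ∎
    where
    sub : P ∩ Q ⊆ (V ∩ X ∪ W ∩ Y) ∪ (V ∩ Y ∪ W ∩ X)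
    sub x∈ with x∈P , x∈Q ← x∈p∩q⁻ P Q x∈ with x∈p∪q⁻ V W x∈P | x∈p∪q⁻ X Y x∈Q
    ... | inj₁ x∈V | inj₁ x∈X = x∈p∪q⁺ (inj₁ (x∈p∪q⁺ (inj₁ (x∈p∩q⁺ (x∈V , x∈X)))))
    ... | inj₂ x∈W | inj₂ x∈Y = x∈p∪q⁺ (inj₁ (x∈p∪q⁺ {p = V ∩ X} (inj₂ (x∈p∩q⁺ (x∈W , x∈Y)))))
    ... | inj₁ x∈V | inj₂ x∈Y =
      x∈p∪q⁺ {p = V ∩ X ∪ W ∩ Y} (inj₂ (x∈p∪q⁺ (inj₁ (x∈p∩q⁺ (x∈V , x∈Y)))))
    ... | inj₂ x∈W | inj₁ x∈X =
      x∈p∪q⁺ {p = V ∩ X ∪ W ∩ Y} (inj₂ (x∈p∪q⁺ {p = V ∩ Y} (inj₂ (x∈p∩q⁺ (x∈W , x∈X)))))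
  dichotomy : {p q : Subset n} → (Nonempty p → ∣ q ∣ ≤ℕ 2) → ∣ p ∣ ≡ 0 ⊎ ∣ q ∣ ≤ℕ 2
  dichotomy {p} f = [ inj₁ , inj₂ ∘ f ]′ (empty⊎nonempty p)
  split : ∀ {k} p q r → ∣ p ∣ ≡ k → Disjoint q r → ∣ p ∩ q ∣ + ∣ p ∩ r ∣ ≤ℕ k
  split p q r ∣p∣ q#r = subst (_ ≤ℕ_) ∣p∣ (∣p∩q∣+∣p∩r∣≤∣p∣ p q r q#r)
  split′ : ∀ {k} p q r → ∣ p ∣ ≡ k → Disjoint q r → ∣ q ∩ p ∣ + ∣ r ∩ p ∣ ≤ℕ k
  split′ p q r ∣p∣ q#r rewrite ∩-comm q p | ∩-comm r p = split p q r ∣p∣ q#r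
  2m≤n+8 : m + m ≤ℕ n + 8
  2m≤n+8 = overlap-bound (∣ V ∩ X ∣) (∣ V ∩ Y ∣) (∣ W ∩ X ∣) (∣ W ∩ Y ∣)
    2s≤n 2t≤n (∣p∣≤n (P ∩ Q)) m≤
    (split V X Y ∣V∣≡s X#Y) (split W X Y ∣W∣≡s X#Y)
    (split′ X V W ∣X∣≡t V#W) (split′ Y V W ∣Y∣≡t V#W)
    -- Exchanging the sides of `M` or `N` turns `∣W∩Y∣≤2` into all four implications.
    (0⊎0⊎≤4 (dichotomy {V ∩ X} {W ∩ Y} (∣W∩Y∣≤2 G M N))
            (dichotomy {W ∩ Y} {V ∩ X} (∣W∩Y∣≤2 G (swap M) (swap N))))
    (0⊎0⊎≤4 (dichotomy {V ∩ Y} {W ∩ X} (∣W∩Y∣≤2 G M (swap N)))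
            (dichotomy {W ∩ X} {V ∩ Y} (∣W∩Y∣≤2 G (swap M) N)))

-- The sum of n ≤ a + s and n ≤ b + t, combined with the bound on s + t. The form avoids division
-- and subtraction.
th*-sum-≥ : (G : Graph n) {a b : ℕ} → IsTh* G a → IsTh* (∁ G) b → 5 * n ≤ℕ 4 * (a + b + 2)
th*-sum-≥ {n} G {a} {b} isa isb with s , M , n≤a+s ← th*-≥ G isa | t , N , n≤b+t ← th*-≥ (∁ G) isb =
  -- Adding `3 * n + 8` to both sides lets the bound on `4 * (s + t)` cancel.
  ℕ.+-cancelˡ-≤ (3 * n + 8) (5 * n) (4 * (a + b + 2)) (begin
    3 * n + 8 + 5 * n                          ≡⟨ eq₁ n ⟩
    4 * (n + n) + 8                            ≤⟨ ℕ.+-monoˡ-≤ 8 (ℕ.*-monoʳ-≤ 4 (ℕ.+-mono-≤ n≤a+s n≤b+t)) ⟩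
    4 * ((a + s) + (b + t)) + 8                ≡⟨ eq₂ a b s t ⟩
    4 * (s + t) + 4 * (a + b + 2)              ≤⟨ ℕ.+-monoˡ-≤ _ (matchings-bound G M N) ⟩
    3 * n + 8 + 4 * (a + b + 2)                ∎)
  where
  open ℕ.≤-Reasoning
  eq₁ : ∀ n → 3 * n + 8 + 5 * n ≡ 4 * (n + n) + 8
  eq₁ = solve-∀
  eq₂ : ∀ a b s t → 4 * ((a + s) + (b + t)) + 8 ≡ 4 * (s + t) + 4 * (a + b + 2)
  eq₂ = solve-∀

-- Rational arithmetic

-- Comparisons are made on unnormalised rationals, since `_/_` reduces to lowest terms. `mkℚᵘ`
-- stores the denominator minus one: below, 3 stands for 4 and 0 for 1.
/-mono-≤ : ∀ p q → p ℚᵘ.≤ q → ℚ.fromℚᵘ p ≤ ℚ.fromℚᵘ q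
/-mono-≤ p q p≤q = ℚ.toℚᵘ-cancel-≤ (begin
  ℚ.toℚᵘ (ℚ.fromℚᵘ p)   ≃⟨ ℚ.toℚᵘ-fromℚᵘ p ⟩
  p                     ≤⟨ p≤q ⟩
  q                     ≃⟨ ℚ.toℚᵘ-fromℚᵘ q ⟨
  ℚ.toℚᵘ (ℚ.fromℚᵘ q)   ∎)
  where open ℚᵘ.≤-Reasoning

⟦⟧-+ : ∀ k l → ⟦ k + l ⟧ ≡ ⟦ k ⟧ ℚ.+ ⟦ l ⟧
⟦⟧-+ k l = ℚ.toℚᵘ-injective (begin
  ℚ.toℚᵘ ⟦ k + l ⟧                ≈⟨ ℚ.toℚᵘ-fromℚᵘ (mkℚᵘ (ℤ.+ (k + l)) 0) ⟩
  mkℚᵘ (ℤ.+ (k + l)) 0              ≈⟨ *≡* (cong (ℤ._* ℤ.1ℤ) k+l≡) ⟩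
  mkℚᵘ (ℤ.+ k) 0 ℚᵘ.+ mkℚᵘ (ℤ.+ l) 0  ≈⟨ ℚᵘ.+-cong (ℚ.toℚᵘ-fromℚᵘ (mkℚᵘ (ℤ.+ k) 0))
                                               (ℚ.toℚᵘ-fromℚᵘ (mkℚᵘ (ℤ.+ l) 0)) ⟨
  ℚ.toℚᵘ ⟦ k ⟧ ℚᵘ.+ ℚ.toℚᵘ ⟦ l ⟧  ≈⟨ ℚ.toℚᵘ-homo-+ ⟦ k ⟧ ⟦ l ⟧ ⟨
  ℚ.toℚᵘ (⟦ k ⟧ ℚ.+ ⟦ l ⟧)        ∎)
  where
  open import Relation.Binary.Reasoning.Setoid ℚᵘ.≃-setoid
  k+l≡ : ℤ.+ (k + l) ≡ (ℤ.+ k) ℤ.* ℤ.1ℤ ℤ.+ (ℤ.+ l) ℤ.* ℤ.1ℤ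
  k+l≡ = sym (cong₂ ℤ._+_ (ℤ.*-identityʳ (ℤ.+ k)) (ℤ.*-identityʳ (ℤ.+ l)))

lowerBound-≤ : ∀ n k → 5 * n ≤ℕ 4 * (k + 2) → lowerBound n ≤ ⟦ k ⟧
lowerBound-≤ n k 5n≤ = begin
  ℤ.+ (5 * n) ℚ./ 4 ℚ.- ⟦ 2 ⟧     ≤⟨ ℚ.+-monoˡ-≤ (ℚ.- ⟦ 2 ⟧) (/-mono-≤ (mkℚᵘ (ℤ.+ (5 * n)) 3)
                                    (mkℚᵘ (ℤ.+ (k + 2)) 0) (*≤* 5n*1≤)) ⟩
  ⟦ k + 2 ⟧ ℚ.- ⟦ 2 ⟧           ≡⟨ cong (ℚ._- ⟦ 2 ⟧) (⟦⟧-+ k 2) ⟩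
  ⟦ k ⟧ ℚ.+ ⟦ 2 ⟧ ℚ.- ⟦ 2 ⟧     ≡⟨ //-rightDividesʳ ⟦ 2 ⟧ ⟦ k ⟧ ⟩
  ⟦ k ⟧                         ∎
  where
  open ℚ.≤-Reasoning
  5n*1≤ : (ℤ.+ (5 * n)) ℤ.* (ℤ.+ 1) ℤ.≤ (ℤ.+ (k + 2)) ℤ.* (ℤ.+ 4)
  5n*1≤ = subst₂ ℤ._≤_ (ℤ.pos-* (5 * n) 1) (ℤ.pos-* (k + 2) 4)
    (ℤ.+≤+ (subst₂ _≤ℕ_ (sym (ℕ.*-identityʳ (5 * n))) (ℕ.*-comm 4 (k + 2)) 5n≤))

-- At order 4 r the bound is 5 r - 2, while the extremal family attains 2 r + 3 r.
lowerBound-4∣ : ∀ r → ⟦ 5 * r ⟧ ≡ lowerBound (2 * r + 2 * r) ℚ.+ ⟦ 2 ⟧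
lowerBound-4∣ r = trans
  (ℚ.fromℚᵘ-cong {mkℚᵘ (ℤ.+ (5 * r)) 0} {mkℚᵘ (ℤ.+ (5 * (2 * r + 2 * r))) 3}
    (*≡* (trans (sym (ℤ.pos-* (5 * r) 4)) (trans (cong ℤ.+_ (eq r)) (ℤ.pos-* (5 * (2 * r + 2 * r)) 1)))))
  (sym (//-rightDividesˡ ⟦ 2 ⟧ _))
  where
  eq : ∀ r → 5 * r * 4 ≡ 5 * (2 * r + 2 * r) * 1
  eq = solve-∀

-- The extremal family

-- Provides two distinct neighbours of a would-be leaf and detours in the crown; hence the sizes
-- `3 + r`.
third : ∀ {r} (i j : Fin (3 + r)) → ∃[ k ] k ≢ i × k ≢ j
third zero          zero          = suc zero       , (λ ()) , λ ()
third zero          (suc zero)    = suc (suc zero) , (λ ()) , λ ()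
third zero          (suc (suc _)) = suc zero       , (λ ()) , λ ()
third (suc zero)    zero          = suc (suc zero) , (λ ()) , λ ()
third (suc (suc _)) zero          = suc zero       , (λ ()) , λ ()
third (suc _)       (suc _)       = zero           , (λ ()) , λ ()

-- Adjacency below is computed through `splitAt` or `remQuot`, so it agrees with the intended
-- relation only up to a propositional equality of types.
cast : {A B : Set} → A ≡ B → A → B
cast refl = id

-- Coronas: a pendant leaf at each vertex

module Corona {h} (H : Graph h) where

  E : Fin h ⊎ Fin h → Fin h ⊎ Fin h → Set
  E (inj₁ a) (inj₁ b) = Adj H a b
  E (inj₁ a) (inj₂ b) = a ≡ b
  E (inj₂ a) (inj₁ b) = a ≡ b
  E (inj₂ _) (inj₂ _) = Empty.⊥

  E? : ∀ x y → Dec (E x y)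
  E? (inj₁ a) (inj₁ b) = adj? H a b
  E? (inj₁ a) (inj₂ b) = a ≟ b
  E? (inj₂ a) (inj₁ b) = a ≟ b
  E? (inj₂ _) (inj₂ _) = no id

  E-sym : ∀ x y → E x y → E y x
  E-sym (inj₁ _) (inj₁ _) = symm H
  E-sym (inj₁ _) (inj₂ _) = sym
  E-sym (inj₂ _) (inj₁ _) = sym
  E-sym (inj₂ _) (inj₂ _) = id

  E-irrefl : ∀ x → ¬ E x x
  E-irrefl (inj₁ _) = irrefl H refl
  E-irrefl (inj₂ _) = id

  corona : Graph (h + h)
  corona .Adj u v        = E (splitAt h u) (splitAt h v)
  corona .adj? u v       = E? (splitAt h u) (splitAt h v)
  corona .symm {u} {v}   = E-sym (splitAt h u) (splitAt h v)
  corona .irrefl {u} refl = E-irrefl (splitAt h u)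

  core leaf : Fin h → Fin (h + h)
  core a = a ↑ˡ h
  leaf a = h ↑ʳ a

  data View : Fin (h + h) → Set where
    atCore : ∀ a → View (core a)
    atLeaf : ∀ a → View (leaf a)

  view : ∀ u → View u
  view u with splitAt h u in eq
  ... | inj₁ a = subst View (splitAt⁻¹-↑ˡ eq) (atCore a)
  ... | inj₂ a = subst View (splitAt⁻¹-↑ʳ eq) (atLeaf a)

  core≢leaf : ∀ a b → core a ≢ leaf b
  core≢leaf a b eq with () ← trans (sym (splitAt-↑ˡ h a h)) (trans (cong (splitAt h) eq) (splitAt-↑ʳ h h b))

  core-core : ∀ a b → Adj corona (core a) (core b) ≡ Adj H a b
  core-core a b = cong₂ E (splitAt-↑ˡ h a h) (splitAt-↑ˡ h b h)

  core-leaf : ∀ a b → Adj corona (core a) (leaf b) ≡ (a ≡ b)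
  core-leaf a b = cong₂ E (splitAt-↑ˡ h a h) (splitAt-↑ʳ h h b)

  leaf-leaf : ∀ a b → Adj corona (leaf a) (leaf b) ≡ Empty.⊥
  leaf-leaf a b = cong₂ E (splitAt-↑ʳ h h a) (splitAt-↑ʳ h h b)

  leaf-unique : ∀ a {u v} → Adj corona (leaf a) u → Adj corona (leaf a) v → u ≡ v
  leaf-unique a {u} {v} au av = trans (only u au) (sym (only v av))
    where
    only : ∀ u → Adj corona (leaf a) u → u ≡ core a
    only u au with view u
    ... | atCore b = cong core (cast (core-leaf b a) (symm corona {leaf a} {core b} au))
    ... | atLeaf b = ⊥-elim (cast (leaf-leaf a b) au)

  -- It covers all vertices, so no matching of the corona is larger.
  coronaMatching : Matching corona h
  coronaMatching = record
    { v = core ; w = leaf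
    ; matched = λ a → cast (sym (core-leaf a a)) refl
    ; induced = λ {a} {b} → cast (core-leaf a b)
    ; disjoint = core≢leaf }

  ∁-core-core⁺ : ∀ {a b} → Adj (∁ H) a b → Adj (∁ corona) (core a) (core b)
  ∁-core-core⁺ (a≢b , ¬ab) = a≢b ∘ ↑ˡ-injective h _ _ , ¬ab ∘ cast (core-core _ _)

  ∁-core-core⁻ : ∀ {a b} → Adj (∁ corona) (core a) (core b) → Adj (∁ H) a b
  ∁-core-core⁻ (≢ , ¬ab) = ≢ ∘ cong core , ¬ab ∘ cast (sym (core-core _ _))

  liftMatching : Matching (∁ H) t → Matching (∁ corona) t
  liftMatching M = record
    { v = core ∘ v ; w = core ∘ w
    ; matched = ∁-core-core⁺ ∘ matched
    ; induced = induced ∘ ∁-core-core⁻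
    ; disjoint = λ i j → disjoint i j ∘ ↑ˡ-injective h _ _ }
    where open Matching M

  -- For t ≥ 3 every matched vertex has two neighbours, so none is a leaf.
  isCore : (M : Matching (∁ corona) (3 + t)) → ∀ i → ∃[ a ] Matching.v M i ≡ core a
  isCore M i with Matching.v M i in vi | view (Matching.v M i)
  ... | _ | atCore a = a , refl
  ... | _ | atLeaf a =
    let j , j≢i , _   = third i i
        k , k≢i , k≢j = third i j
    in contradiction (w-injective (leaf-unique a (adj (j≢i ∘ sym)) (adj (k≢i ∘ sym)))) (k≢j ∘ sym)
    where
    open Matching M
    -- Distinct vertices not joined in the complement are joined in the corona.
    adj : ∀ {j} → i ≢ j → Adj corona (leaf a) (w j)
    adj {j} i≢j = subst (λ u → Adj corona u (w j)) vi (decidable-stable (adj? corona (v i) (w j))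
      λ ¬a → i≢j (induced (disjoint i j , ¬a)))

  -- Matchings of size at least three live on the core, so they have only `h` vertices available
  -- instead of `h + h`.
  restrictMatching : Matching (∁ corona) (3 + t) → Matching (∁ H) (3 + t)
  restrictMatching M = record
    { v = a ; w = b
    ; matched  = λ i → ∁-core-core⁻ (subst₂ (Adj (∁ corona)) (v≡ i) (w≡ i) (matched i))
    ; induced  = λ {i} {j} → induced ∘ subst₂ (Adj (∁ corona)) (sym (v≡ i)) (sym (w≡ j)) ∘ ∁-core-core⁺
    ; disjoint = λ i j eq → disjoint i j (trans (v≡ i) (trans (cong core eq) (sym (w≡ j)))) }
    where
    open Matching M
    a  = proj₁ ∘ isCore M
    v≡ = proj₂ ∘ isCore M
    b  = proj₁ ∘ isCore (swap M)
    w≡ = proj₂ ∘ isCore (swap M)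

  corona-connected : Connected H → Connected corona
  corona-connected H-conn u v = toCore u ◅◅ gmap core (cast (sym (core-core _ _))) (H-conn _ _)
                                         ◅◅ reverse (λ {x} {y} → symm corona {x} {y}) (toCore v)
    where
    base : Fin (h + h) → Fin h
    base u = [ id , id ]′ (splitAt h u)
    toCore : ∀ u → Star (Adj corona) u (core (base u))
    toCore u with splitAt h u in eq
    ... | inj₁ a = subst (λ x → Star (Adj corona) x (core a)) (splitAt⁻¹-↑ˡ eq) ε
    ... | inj₂ a = subst (λ x → Star (Adj corona) x (core a)) (splitAt⁻¹-↑ʳ eq)
                     (symm corona {core a} {leaf a} (cast (sym (core-leaf a a)) refl) ◅ ε)

  ∁-leaf-leaf : ∀ {a b} → a ≢ b → Adj (∁ corona) (leaf a) (leaf b)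
  ∁-leaf-leaf a≢b = a≢b ∘ ↑ʳ-injective h _ _ , cast (leaf-leaf _ _)

  ∁-core-leaf : ∀ {a b} → a ≢ b → Adj (∁ corona) (core a) (leaf b)
  ∁-core-leaf a≢b = core≢leaf _ _ , a≢b ∘ cast (core-leaf _ _)

  -- In the complement the leaves form a clique, and each core vertex is adjacent to every leaf but
  -- its own.
  ∁-corona-connected : (∀ a → ∃[ b ] a ≢ b) → Connected (∁ corona)
  ∁-corona-connected other u v =
    let a , ua = toLeaf u (view u)
        b , vb = toLeaf v (view v)
    in ua ◅◅ leaves a b ◅◅ reverse (λ {x} {y} → symm (∁ corona) {x} {y}) vb
    where
    toLeaf : ∀ u → View u → ∃[ a ] Star (Adj (∁ corona)) u (leaf a)
    toLeaf _ (atLeaf a) = a , ε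
    toLeaf _ (atCore a) = let b , a≢b = other a in b , ∁-core-leaf a≢b ◅ ε
    leaves : ∀ a b → Star (Adj (∁ corona)) (leaf a) (leaf b)
    leaves a b with a ≟ b
    ... | yes refl = ε
    ... | no  a≢b  = ∁-leaf-leaf a≢b ◅ ε

-- The tensor product of K₂ and K_r, that is, K_{r,r} minus a perfect matching.
module Crown (r : ℕ) where

  split : Fin (2 * r) → Fin 2 × Fin r
  split = remQuot r

  vertex : Fin 2 → Fin r → Fin (2 * r)
  vertex = combine

  split-vertex : ∀ σ i → split (vertex σ i) ≡ (σ , i)
  split-vertex = remQuot-combine

  Differ : Fin 2 × Fin r → Fin 2 × Fin r → Set
  Differ (σ , i) (τ , j) = σ ≢ τ × i ≢ j

  crown : Graph (2 * r)
  crown .Adj u v = Differ (split u) (split v)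
  crown .adj? u v = ¬? (_ ≟ _) ×-dec ¬? (_ ≟ _)
  crown .symm (σ≢τ , i≢j) = σ≢τ ∘ sym , i≢j ∘ sym
  crown .irrefl refl (σ≢σ , _) = σ≢σ refl

  crown-vertex : ∀ σ τ i j → Adj crown (vertex σ i) (vertex τ j) ≡ (σ ≢ τ × i ≢ j)
  crown-vertex σ τ i j = cong₂ Differ (split-vertex σ i) (split-vertex τ j)

  crown⁺ : ∀ {σ τ i j} → σ ≢ τ → i ≢ j → Adj crown (vertex σ i) (vertex τ j)
  crown⁺ {σ} {τ} {i} {j} σ≢τ i≢j = cast (sym (crown-vertex σ τ i j)) (σ≢τ , i≢j)

  crown⁻ : ∀ σ τ {i j} → Adj crown (vertex σ i) (vertex τ j) → i ≢ j
  crown⁻ σ τ {i} {j} = proj₂ ∘ cast (crown-vertex σ τ i j)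

  sides : ∀ i j → vertex zero i ≢ vertex (suc zero) j
  sides i j eq with () ← trans (sym (split-vertex zero i)) (trans (cong split eq) (split-vertex (suc zero) j))

  -- This is the perfect matching removed from K_{r,r}: its edges are the only non-edges of the
  -- crown between the two sides.
  ∁-matching : Matching (∁ crown) r
  ∁-matching = record
    { v = vertex zero ; w = vertex (suc zero)
    ; matched = λ i → sides i i , λ a → crown⁻ zero (suc zero) a refl
    ; induced = λ {i} {j} (_ , ¬a) → decidable-stable (i ≟ j) λ i≢j → ¬a (crown⁺ {zero} {suc zero} (λ ()) i≢j)
    ; disjoint = sides }

flip : Fin 2 → Fin 2
flip zero       = suc zero
flip (suc zero) = zero

≢flip : ∀ σ → σ ≢ flip σ
≢flip zero       ()
≢flip (suc zero) ()

-- With two indices the crown would be two disjoint edges; three are enough to connect it.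
crown-connected : ∀ r → Connected (Crown.crown (3 + r))
crown-connected r u v = subst₂ (Star (Adj crown)) (combine-remQuot {2} (3 + r) u)
  (combine-remQuot {2} (3 + r) v) (uncurry path (split u) (split v))
  where
  open Crown (3 + r)
  edge : ∀ {σ τ i j} → σ ≢ τ → i ≢ j → Star (Adj crown) (vertex σ i) (vertex τ j)
  edge σ≢τ i≢j = crown⁺ σ≢τ i≢j ◅ ε
  within : ∀ σ i j → Star (Adj crown) (vertex σ i) (vertex σ j)
  -- Cross to the other side at a third index and return.
  within σ i j = let k , k≢i , k≢j = third i j in
    edge {σ} {flip σ} {i} {k} (≢flip σ) (k≢i ∘ sym) ◅◅
    edge {flip σ} {σ} {k} {j} (≢flip σ ∘ sym) k≢j
  path : ∀ σ i (y : Fin 2 × Fin (3 + r)) → Star (Adj crown) (vertex σ i) (uncurry vertex y)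
  path σ i (τ , j) with σ ≟ τ
  ... | yes refl = within σ i j
  -- Equal indices are not adjacent, so the walk first moves to an index other than `j`.
  ... | no σ≢τ   = let k , k≢j , _ = third j j
                   in within σ i k ◅◅ edge {σ} {τ} {k} {j} σ≢τ k≢j

-- Stated for an arbitrary graph, on which th* does not evaluate.
th*-sum-≡ : (G : Graph n) (e : HasEdge G) (e′ : HasEdge (∁ G)) (r : ℕ) →
  n ≡ 2 * r + 2 * r → (∀ m → IsTh* G m → m ≡ 2 * r) → (∀ m → IsTh* (∁ G) m → m ≡ 3 * r) →
  ∃[ e ] ∃[ e′ ]
    (⟦ th* G e + th* (∁ G) e′ ⟧ ≡ lowerBound n ℚ.+ ⟦ 2 ⟧ ⊎
     ⟦ th* G e + th* (∁ G) e′ ⟧ ≡ lowerBound n ℚ.- ⟦ 2 ⟧)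
th*-sum-≡ G e e′ r refl th*G th*∁G = e , e′ , inj₁ (trans
  (cong ⟦_⟧ {th* G e + th* (∁ G) e′} {5 * r}
    (trans (cong₂ _+_ (th*G _ (th*-spec G e)) (th*∁G _ (th*-spec (∁ G) e′)))
           (sym (ℕ.*-distribʳ-+ r 2 3))))
  (lowerBound-4∣ r))

-- Throttling numbers of the coronas of crowns

module Extremal (r : ℕ) where
  open Crown (3 + r) using (crown; ∁-matching)
  open Corona crown

  N = 2 * (3 + r) + 2 * (3 + r)

  -- Sizes below three satisfy the bound outright; larger matchings restrict to the crown and cover
  -- at most its 2 (3 + r) vertices.
  ∁-matching-≤ : ∀ {t} → Matching (∁ corona) t → t ≤ℕ 3 + r
  ∁-matching-≤ {0} M = z≤n
  ∁-matching-≤ {1} M = s≤s z≤n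
  ∁-matching-≤ {2} M = s≤s (s≤s z≤n)
  ∁-matching-≤ {suc (suc (suc t))} M = ℕ.*-cancelˡ-≤ 2 (subst (_≤ℕ 2 * (3 + r))
    (cong (λ x → 3 + t + x) (sym (ℕ.+-identityʳ (3 + t)))) (Matching.s+s≤n (restrictMatching M)))

  -- The core-leaf matching gives the upper bound; the lower one holds because both sides of a
  -- matching fit into `N` vertices.
  th*-corona : ∀ m → IsTh* corona m → m ≡ 2 * (3 + r)
  th*-corona m is with s , M , N≤m+s ← th*-≥ corona is = ℕ.≤-antisym upper lower
    where
    upper : m ≤ℕ 2 * (3 + r)
    upper = subst (m ≤ℕ_) (ℕ.m+n∸n≡m (2 * (3 + r)) (2 * (3 + r))) (th*-≤ corona is coronaMatching)
    s≤ : s ≤ℕ 2 * (3 + r)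
    s≤ = ℕ.≮⇒≥ λ lt → ℕ.<⇒≱ (ℕ.+-mono-< lt lt) (Matching.s+s≤n M)
    lower : 2 * (3 + r) ≤ℕ m
    lower = ℕ.+-cancelʳ-≤ (2 * (3 + r)) _ m (ℕ.≤-trans N≤m+s (ℕ.+-monoʳ-≤ m s≤))

  -- The largest matchings have size 3 + r, a quarter of `N`, which leaves three quarters.
  th*-∁-corona : ∀ m → IsTh* (∁ corona) m → m ≡ 3 * (3 + r)
  th*-∁-corona m is with t , M , N≤m+t ← th*-≥ (∁ corona) is = ℕ.≤-antisym upper lower
    where
    N≡ : N ≡ 3 * (3 + r) + (3 + r)
    N≡ = eq r
      where
      eq : ∀ r → 2 * (3 + r) + 2 * (3 + r) ≡ 3 * (3 + r) + (3 + r)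
      eq = solve-∀
    upper : m ≤ℕ 3 * (3 + r)
    upper = subst (m ≤ℕ_) (trans (cong (_∸ (3 + r)) N≡) (ℕ.m+n∸n≡m (3 * (3 + r)) (3 + r)))
              (th*-≤ (∁ corona) is (liftMatching ∁-matching))
    lower : 3 * (3 + r) ≤ℕ m
    lower = ℕ.+-cancelʳ-≤ (3 + r) _ m (subst (_≤ℕ m + (3 + r)) N≡
              (ℕ.≤-trans N≤m+t (ℕ.+-monoʳ-≤ m (∁-matching-≤ M))))

  hasEdge : HasEdge corona
  hasEdge = core zero , leaf zero , Matching.matched coronaMatching zero

  hasEdge-∁ : HasEdge (∁ corona)
  hasEdge-∁ = leaf zero , leaf (suc zero) , ∁-leaf-leaf {zero} {suc zero} λ ()

theorem2p11 : (∀ n → 2 ≤ℕ n → (G : Graph n) (e : HasEdge G) (e′ : HasEdge (∁ G)) →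
    lowerBound n ≤ ⟦ th* G e + th* (∁ G) e′ ⟧)
    × AlmostSharp (λ G → Connected G × Connected (∁ G)) th* lowerBound
theorem2p11 =
  (λ n _ G e e′ → lowerBound-≤ n (th* G e + th* (∁ G) e′) (th*-sum-≥ G (th*-spec G e) (th*-spec (∁ G) e′))) ,
  -- The sums exceed the bound by exactly two.
  2 , s≤s z≤n , s≤s (s≤s (s≤s z≤n)) ,
  family ,
  (λ r → (Corona.corona-connected (Crown.crown (3 + r)) (crown-connected r) ,
          Corona.∁-corona-connected (Crown.crown (3 + r)) λ { zero → suc zero , λ () ; (suc _) → zero , λ () }) ,
         th*-sum-≡ {proj₁ (family r)} (proj₂ (family r)) (Extremal.hasEdge r) (Extremal.hasEdge-∁ r)
           (3 + r) refl (Extremal.th*-corona r) (Extremal.th*-∁-corona r)) ,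
  -- Isomorphic graphs have equal order, and the order 4 (3 + r) determines `r`.
  λ r r′ (φ , _) → order-injective r r′ (↔⇒≡ φ)
  where
  family : ℕ → ∃ Graph
  family r = _ , Corona.corona (Crown.crown (3 + r))
  order-injective : ∀ r r′ → 2 * (3 + r) + 2 * (3 + r) ≡ 2 * (3 + r′) + 2 * (3 + r′) → r ≡ r′
  order-injective r r′ eq = ℕ.+-cancelˡ-≡ 3 r r′ (ℕ.*-cancelˡ-≡ _ _ 4
    (trans (4* (3 + r)) (trans eq (sym (4* (3 + r′))))))
    where
    4* : ∀ x → 4 * x ≡ 2 * x + 2 * x
    4* = solve-∀
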